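{- Let $\mathbb{F}_4$ be the field with $4$ elements. If $f\in\mathbb{F}_4[x]$ is a product of linear factors over $\mathbb{F}_4$ such that all of the coefficients of $x^0,x^1,\ldots,x^{\deg f}$ in $f$ are nonzero, then the base $4$ expansion of $\deg(f)+1$ has at most $4$ nonzero digits. Moreover, the value $4$ is attained by some such $f$. -}

module Defs where

open import Algebra.Structures using (IsCommutativeRing)
open import Data.Digit using (toDigits)
open import Data.List using (List; []; _∷_; map; foldr; filter; length)
open import Data.List.Relation.Unary.All using (All)
open import Data.Nat using (ℕ; zero; suc; _≤_; _<_)
import Data.Fin.Base as Fin
import Data.Fin.Properties as Fin
open import Data.Product using (_×_; _,_; proj₁; ∃-syntax)
open import Function using (id)
open import Relation.Binary.Definitions using (DecidableEquality)
open import Relation.Binary.PropositionalEquality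
  using (_≡_; _≢_; refl; cong₂; isEquivalence)
open import Relation.Nullary.Decidable
  using (Dec; yes; no; ¬?; map′; _×-dec_; _→-dec_; from-yes)
open import Relation.Unary using (Pred; Decidable)

-- The field with four elements, presented as 𝔽₂(ω) with
-- ω² + ω + 1 = 0; the constructor ω² is the square of ω.

data 𝔽₄ : Set where
  0# 1# ω ω² : 𝔽₄

infixl 6 _+_ _+ₚ_
infixl 7 _*_ _·ₚ_ _*ₚ_
infix  8 _⁻¹
infix  4 _≟_ _≈ₚ_

_+_ : 𝔽₄ → 𝔽₄ → 𝔽₄
0# + y  = y
1# + 0# = 1#
1# + 1# = 0#
1# + ω  = ω²
1# + ω² = ω
ω  + 0# = ω
ω  + 1# = ω²
ω  + ω  = 0#
ω  + ω² = 1#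
ω² + 0# = ω²
ω² + 1# = ω
ω² + ω  = 1#
ω² + ω² = 0#

_*_ : 𝔽₄ → 𝔽₄ → 𝔽₄
0# * y  = 0#
1# * y  = y
ω  * 0# = 0#
ω  * 1# = ω
ω  * ω  = ω²
ω  * ω² = 1#
ω² * 0# = 0#
ω² * 1# = ω²
ω² * ω  = 1#
ω² * ω² = ω

-- The value at 0# is junk.

_⁻¹ : 𝔽₄ → 𝔽₄
0# ⁻¹ = 0#
1# ⁻¹ = 1#
ω  ⁻¹ = ω²
ω² ⁻¹ = ω

_≟_ : DecidableEquality 𝔽₄
0# ≟ 0# = yes refl
0# ≟ 1# = no λ ()
0# ≟ ω  = no λ ()
0# ≟ ω² = no λ ()
1# ≟ 0# = no λ ()
1# ≟ 1# = yes refl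
1# ≟ ω  = no λ ()
1# ≟ ω² = no λ ()
ω  ≟ 0# = no λ ()
ω  ≟ 1# = no λ ()
ω  ≟ ω  = yes refl
ω  ≟ ω² = no λ ()
ω² ≟ 0# = no λ ()
ω² ≟ 1# = no λ ()
ω² ≟ ω  = no λ ()
ω² ≟ ω² = yes refl

all? : ∀ {p} {P : Pred 𝔽₄ p} → Decidable P → Dec (∀ x → P x)
all? {P = P} P? =
  map′ to (λ f → f 0# , f 1# , f ω , f ω²)
    (P? 0# ×-dec P? 1# ×-dec P? ω ×-dec P? ω²)
  where
  to : P 0# × P 1# × P ω × P ω² → ∀ x → P x
  to (a , b , c , d) 0# = a
  to (a , b , c , d) 1# = b
  to (a , b , c , d) ω  = c
  to (a , b , c , d) ω² = d

+-comm : ∀ x y → x + y ≡ y + x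
+-comm = from-yes (all? λ x → all? λ y → x + y ≟ y + x)

+-assoc : ∀ x y z → (x + y) + z ≡ x + (y + z)
+-assoc = from-yes
  (all? λ x → all? λ y → all? λ z → (x + y) + z ≟ x + (y + z))

+-identityʳ : ∀ x → x + 0# ≡ x
+-identityʳ = from-yes (all? λ x → x + 0# ≟ x)

x+x≡0 : ∀ x → x + x ≡ 0#
x+x≡0 = from-yes (all? λ x → x + x ≟ 0#)

*-comm : ∀ x y → x * y ≡ y * x
*-comm = from-yes (all? λ x → all? λ y → x * y ≟ y * x)

*-assoc : ∀ x y z → (x * y) * z ≡ x * (y * z)
*-assoc = from-yes
  (all? λ x → all? λ y → all? λ z → (x * y) * z ≟ x * (y * z))

*-identityʳ : ∀ x → x * 1# ≡ x
*-identityʳ = from-yes (all? λ x → x * 1# ≟ x)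

*-distribˡ-+ : ∀ x y z → x * (y + z) ≡ x * y + x * z
*-distribˡ-+ = from-yes
  (all? λ x → all? λ y → all? λ z → x * (y + z) ≟ x * y + x * z)

*-distribʳ-+ : ∀ x y z → (y + z) * x ≡ y * x + z * x
*-distribʳ-+ = from-yes
  (all? λ x → all? λ y → all? λ z → (y + z) * x ≟ y * x + z * x)

*-inverseʳ : ∀ x → x ≢ 0# → x * x ⁻¹ ≡ 1#
*-inverseʳ = from-yes
  (all? λ x → ¬? (x ≟ 0#) →-dec (x * x ⁻¹ ≟ 1#))

-- Negation is the identity, since the characteristic is 2.

+-*-isCommutativeRing : IsCommutativeRing _≡_ _+_ _*_ id 0# 1#
+-*-isCommutativeRing = record
  { isRing = record
    { +-isAbelianGroup = record
      { isGroup = record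
        { isMonoid = record
          { isSemigroup = record
            { isMagma = record
              { isEquivalence = isEquivalence ; ∙-cong = cong₂ _+_ }
            ; assoc = +-assoc
            }
          ; identity = (λ _ → refl) , +-identityʳ
          }
        ; inverse = x+x≡0 , x+x≡0
        ; ⁻¹-cong = id
        }
      ; comm = +-comm
      }
    ; *-cong     = cong₂ _*_
    ; *-assoc    = *-assoc
    ; *-identity = (λ _ → refl) , *-identityʳ
    ; distrib    = *-distribˡ-+ , *-distribʳ-+
    }
  ; *-comm = *-comm
  }

-- Polynomials over 𝔽₄ as coefficient lists, constant term first.
-- Trailing zeros are allowed, so polynomials are compared by _≈ₚ_.

Poly : Set
Poly = List 𝔽₄

coeff : Poly → ℕ → 𝔽₄
coeff []      _       = 0#
coeff (a ∷ p) zero    = a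
coeff (a ∷ p) (suc i) = coeff p i

_≈ₚ_ : Poly → Poly → Set
p ≈ₚ q = ∀ i → coeff p i ≡ coeff q i

_+ₚ_ : Poly → Poly → Poly
[]      +ₚ q       = q
(a ∷ p) +ₚ []      = a ∷ p
(a ∷ p) +ₚ (b ∷ q) = (a + b) ∷ (p +ₚ q)

_·ₚ_ : 𝔽₄ → Poly → Poly
c ·ₚ p = map (c *_) p

-- (a + x p) q = a q + x (p q)

_*ₚ_ : Poly → Poly → Poly
[]      *ₚ q = []
(a ∷ p) *ₚ q = (a ·ₚ q) +ₚ (0# ∷ (p *ₚ q))

1ₚ : Poly
1ₚ = 1# ∷ []

productₚ : List Poly → Poly
productₚ = foldr _*ₚ_ 1ₚ

-- The zero polynomial has no degree in this sense.

HasDegree : Poly → ℕ → Set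
HasDegree p n = coeff p n ≢ 0# × (∀ m → n < m → coeff p m ≡ 0#)

Linear : Poly → Set
Linear p = HasDegree p 1

-- Linear factors need not be monic.

IsProductOfLinearFactors : Poly → Set
IsProductOfLinearFactors f = ∃[ ls ] All Linear ls × f ≈ₚ productₚ ls

AllCoefficientsNonzeroUpTo : ℕ → Poly → Set
AllCoefficientsNonzeroUpTo n f = ∀ i → i ≤ n → coeff f i ≢ 0#

nonzeroDigits₄ : ℕ → ℕ
nonzeroDigits₄ n =
  length (filter (λ d → ¬? (d Fin.≟ Fin.zero)) (proj₁ (toDigits 4 n)))

{-# OPTIONS --safe #-}

-- Grouping exponents by base 4 digits writes f as c · L(x) · P(x⁴), where P
-- is again a product of linear factors with constant term 1 and L is one of
-- the 64 products (1+x)^a (1+ωx)^b (1+ω²x)^c with a, b, c < 4.  The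
-- coefficients of f in a residue class mod 4 are those of R · P, where R is
-- the corresponding section of L.  Call P full if its coefficients up to
-- deg P are all nonzero, and let T(P) be the set of t ≠ 0 such that
-- (1 + t x) P is also full (the t that are not ratios of consecutive
-- coefficients of P).  For a full f the sections of L and of (1 + t x) L,
-- t ∈ T(f), exhibit elements of T(P), and a check of all T and L shows that
-- either P is constant, or the last digit of deg f + 1 is removed without a
-- change of carry and |T(P)| exceeds |T(f)| by at least one if that digit is
-- nonzero.  As |T| ≤ 3, at most 4 digits are nonzero.

module Submission where

open import Defs
open import Algebra.Bundles using (CommutativeRing)
import Algebra.Properties.CommutativeSemigroup as CommutativeSemigroupProperties
open import Data.Bool using (Bool; true; false; if_then_else_)
open import Data.Digit using (toDigits; fromDigits)
open import Data.Fin as Fin using (Fin; toℕ)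
open import Data.Fin.Patterns using (0F; 1F; 2F; 3F)
import Data.Fin.Properties as Fin
open import Data.List
  using (List; []; _∷_; _++_; map; concatMap; filter; length; replicate; allFin)
import Data.List.Properties as List
open import Data.List.Membership.Propositional using (_∈_)
open import Data.List.Relation.Unary.All as All using (All; []; _∷_)
import Data.List.Relation.Unary.All.Properties as All
open import Data.List.Relation.Unary.Any as Any using (Any)
open import Data.Nat as ℕ using (ℕ; zero; suc; _≤_; _<_; _∸_; z≤n; s≤s)
open import Data.Nat.DivMod
  using (_/_; _%_; _mod_; _divMod_; DivMod; [m+kn]%n≡m%n; m<n⇒m%n≡m; m/n*n≤m)
import Data.Nat.Properties as ℕ
open import Data.Nat.Tactic.RingSolver using (solve-∀)
open import Data.Product using (_×_; _,_; proj₁; proj₂; ∃-syntax)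
open import Data.Sum using (_⊎_; inj₁; inj₂)
open import Function using (_∘_)
open import Level using (0ℓ)
open import Relation.Binary.Bundles using (Setoid)
import Relation.Binary.Definitions as Binary
open import Relation.Binary.PropositionalEquality
  using (_≡_; _≢_; _≗_; refl; sym; trans; cong; cong₂; subst; module ≡-Reasoning)
import Relation.Binary.Reasoning.Setoid as SetoidReasoning
open import Relation.Nullary using (Dec; yes; contradiction)
open import Relation.Nullary.Decidable
  using (from-yes; map′; ¬?; _×-dec_; _⊎-dec_; _→-dec_)

-- The ring structure of `𝔽₄` and its lack of zero divisors

𝔽₄-commutativeRing : CommutativeRing 0ℓ 0ℓ
𝔽₄-commutativeRing = record { isCommutativeRing = +-*-isCommutativeRing }

open CommutativeRing 𝔽₄-commutativeRing
  using (zeroʳ; +-commutativeSemigroup; *-commutativeSemigroup)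
open CommutativeSemigroupProperties +-commutativeSemigroup using ()
  renaming (interchange to +-interchange)
open CommutativeSemigroupProperties *-commutativeSemigroup using ()
  renaming (x∙yz≈y∙xz to *-exchange)

x*y≡0⇒x≡0⊎y≡0 : ∀ x y → x * y ≡ 0# → x ≡ 0# ⊎ y ≡ 0#
x*y≡0⇒x≡0⊎y≡0 = from-yes (all? λ x → all? λ y →
  (x * y ≟ 0#) →-dec (x ≟ 0# ⊎-dec y ≟ 0#))

*-≢0 : ∀ {x y} → x ≢ 0# → y ≢ 0# → x * y ≢ 0#
*-≢0 {x} {y} x≢0 y≢0 xy≡0 with x*y≡0⇒x≡0⊎y≡0 x y xy≡0
... | inj₁ x≡0 = x≢0 x≡0
... | inj₂ y≡0 = y≢0 y≡0

-- Polynomial arithmetic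

≈ₚ-setoid : Setoid 0ℓ 0ℓ
≈ₚ-setoid = record
  { Carrier = Poly
  ; _≈_ = _≈ₚ_
  ; isEquivalence = record
    { refl  = λ _ → refl
    ; sym   = λ p≈q i → sym (p≈q i)
    ; trans = λ p≈q q≈r i → trans (p≈q i) (q≈r i)
    }
  }

-- An overhanging tail is compared with `[]`, that is, tested for being zero. Polynomial identities
-- over finitely many parameters thereby become matters of evaluation.
infix 4 _≈?_
_≈?_ : Binary.Decidable _≈ₚ_
[]      ≈? []      = yes λ _ → refl
[]      ≈? (b ∷ q) = map′ (λ { (e , _) zero → e ; (_ , e) (suc i) → e i })
                          (λ e → e 0 , e ∘ suc) (0# ≟ b ×-dec [] ≈? q)
(a ∷ p) ≈? []      = map′ (λ { (e , _) zero → e ; (_ , e) (suc i) → e i })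
                          (λ e → e 0 , e ∘ suc) (a ≟ 0# ×-dec p ≈? [])
(a ∷ p) ≈? (b ∷ q) = map′ (λ { (e , _) zero → e ; (_ , e) (suc i) → e i })
                          (λ e → e 0 , e ∘ suc) (a ≟ b ×-dec p ≈? q)

coeff-+ₚ : ∀ p q i → coeff (p +ₚ q) i ≡ coeff p i + coeff q i
coeff-+ₚ []      q       i       = refl
coeff-+ₚ (a ∷ p) []      i       = sym (+-identityʳ _)
coeff-+ₚ (a ∷ p) (b ∷ q) zero    = refl
coeff-+ₚ (a ∷ p) (b ∷ q) (suc i) = coeff-+ₚ p q i

coeff-·ₚ : ∀ c p i → coeff (c ·ₚ p) i ≡ c * coeff p i
coeff-·ₚ c []      i       = sym (zeroʳ c)
coeff-·ₚ c (a ∷ p) zero    = refl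
coeff-·ₚ c (a ∷ p) (suc i) = coeff-·ₚ c p i

coeff-*ₚ-zero : ∀ a p q → coeff ((a ∷ p) *ₚ q) 0 ≡ a * coeff q 0
coeff-*ₚ-zero a p q = begin
  coeff ((a ∷ p) *ₚ q) 0      ≡⟨ coeff-+ₚ (a ·ₚ q) _ 0 ⟩
  coeff (a ·ₚ q) 0 + 0#       ≡⟨ +-identityʳ _ ⟩
  coeff (a ·ₚ q) 0            ≡⟨ coeff-·ₚ a q 0 ⟩
  a * coeff q 0               ∎
  where open ≡-Reasoning

coeff-*ₚ-suc : ∀ a p q i →
  coeff ((a ∷ p) *ₚ q) (suc i) ≡ a * coeff q (suc i) + coeff (p *ₚ q) i
coeff-*ₚ-suc a p q i =
  trans (coeff-+ₚ (a ·ₚ q) _ (suc i)) (cong (_+ _) (coeff-·ₚ a q (suc i)))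

-- The Cauchy product of sequences. Sequences have no trailing zeros to account for, so the laws of
-- `_*ₚ_` up to `_≈ₚ_` are proved here and transferred by `coeff-*ₚ`.
convolve : (ℕ → 𝔽₄) → (ℕ → 𝔽₄) → ℕ → 𝔽₄
convolve f g zero    = f 0 * g 0
convolve f g (suc i) = f 0 * g (suc i) + convolve (f ∘ suc) g i

convolve-cong : ∀ {f f′ g g′} → f ≗ f′ → g ≗ g′ → convolve f g ≗ convolve f′ g′
convolve-cong f≗f′ g≗g′ zero    = cong₂ _*_ (f≗f′ 0) (g≗g′ 0)
convolve-cong f≗f′ g≗g′ (suc i) =
  cong₂ _+_ (cong₂ _*_ (f≗f′ 0) (g≗g′ (suc i))) (convolve-cong (f≗f′ ∘ suc) g≗g′ i)

convolve-constantˡ : ∀ {f} g → (∀ i → f (suc i) ≡ 0#) →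
  ∀ i → convolve f g i ≡ f 0 * g i
convolve-constantˡ     g f≡0 zero    = refl
convolve-constantˡ {f} g f≡0 (suc i) = begin
  f 0 * g (suc i) + convolve (f ∘ suc) g i ≡⟨ cong (f 0 * g (suc i) +_) (convolve-constantˡ g (f≡0 ∘ suc) i) ⟩
  f 0 * g (suc i) + f 1 * g i              ≡⟨ cong (λ y → f 0 * g (suc i) + y * g i) (f≡0 0) ⟩
  f 0 * g (suc i) + 0#                     ≡⟨ +-identityʳ _ ⟩
  f 0 * g (suc i)                          ∎
  where open ≡-Reasoning

convolve-distribʳ : ∀ f f′ g i →
  convolve (λ k → f k + f′ k) g i ≡ convolve f g i + convolve f′ g i
convolve-distribʳ f f′ g zero    = *-distribʳ-+ (g 0) (f 0) (f′ 0)
convolve-distribʳ f f′ g (suc i) =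
  trans (cong₂ _+_ (*-distribʳ-+ (g (suc i)) (f 0) (f′ 0))
                   (convolve-distribʳ (f ∘ suc) (f′ ∘ suc) g i))
        (+-interchange (f 0 * g (suc i)) _ _ _)

convolve-scaleˡ : ∀ c f g i → convolve (λ k → c * f k) g i ≡ c * convolve f g i
convolve-scaleˡ c f g zero    = *-assoc c (f 0) (g 0)
convolve-scaleˡ c f g (suc i) =
  trans (cong₂ _+_ (*-assoc c (f 0) (g (suc i))) (convolve-scaleˡ c (f ∘ suc) g i))
        (sym (*-distribˡ-+ c _ _))

convolve-scaleʳ : ∀ c f g i → convolve f (λ k → c * g k) i ≡ c * convolve f g i
convolve-scaleʳ c f g zero    = *-exchange (f 0) c (g 0)
convolve-scaleʳ c f g (suc i) =
  trans (cong₂ _+_ (*-exchange (f 0) c (g (suc i))) (convolve-scaleʳ c (f ∘ suc) g i))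
        (sym (*-distribˡ-+ c _ _))

convolve-assoc : ∀ f g h i →
  convolve (convolve f g) h i ≡ convolve f (convolve g h) i
convolve-assoc f g h zero    = *-assoc (f 0) (g 0) (h 0)
convolve-assoc f g h (suc i) = begin
  f 0 * g 0 * h (suc i) + convolve (convolve f g ∘ suc) h i
    -- `convolve f g ∘ suc` unfolds to a multiple of `g ∘ suc` plus `convolve (f ∘ suc) g`, so
    -- linearity in the left argument reduces the claim to `f ∘ suc`.
    ≡⟨ cong₂ _+_ (*-assoc (f 0) (g 0) _)
                 (convolve-distribʳ (λ k → f 0 * g (suc k)) (convolve (f ∘ suc) g) h i) ⟩
  f 0 * (g 0 * h (suc i)) + (convolve (λ k → f 0 * g (suc k)) h i + convolve (convolve (f ∘ suc) g) h i)
    ≡⟨ cong (f 0 * (g 0 * h (suc i)) +_)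
         (cong₂ _+_ (convolve-scaleˡ (f 0) (g ∘ suc) h i) (convolve-assoc (f ∘ suc) g h i)) ⟩
  f 0 * (g 0 * h (suc i)) + (f 0 * convolve (g ∘ suc) h i + convolve (f ∘ suc) (convolve g h) i)
    ≡⟨ +-assoc (f 0 * (g 0 * h (suc i))) _ _ ⟨
  f 0 * (g 0 * h (suc i)) + f 0 * convolve (g ∘ suc) h i + convolve (f ∘ suc) (convolve g h) i
    ≡⟨ cong (_+ convolve (f ∘ suc) (convolve g h) i) (*-distribˡ-+ (f 0) _ _) ⟨
  f 0 * convolve g h (suc i) + convolve (f ∘ suc) (convolve g h) i
    ∎
  where open ≡-Reasoning

coeff-*ₚ : ∀ p q → coeff (p *ₚ q) ≗ convolve (coeff p) (coeff q)
coeff-*ₚ []      q i       = sym (convolve-constantˡ {coeff []} (coeff q) (λ _ → refl) i)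
coeff-*ₚ (a ∷ p) q zero    = coeff-*ₚ-zero a p q
coeff-*ₚ (a ∷ p) q (suc i) =
  trans (coeff-*ₚ-suc a p q i) (cong (a * coeff q (suc i) +_) (coeff-*ₚ p q i))

*ₚ-cong : ∀ {p p′ q q′} → p ≈ₚ p′ → q ≈ₚ q′ → p *ₚ q ≈ₚ p′ *ₚ q′
*ₚ-cong {p} {p′} {q} {q′} p≈p′ q≈q′ i =
  trans (coeff-*ₚ p q i) (trans (convolve-cong p≈p′ q≈q′ i) (sym (coeff-*ₚ p′ q′ i)))

*ₚ-congˡ : ∀ p {q q′} → q ≈ₚ q′ → p *ₚ q ≈ₚ p *ₚ q′
*ₚ-congˡ p {q} {q′} = *ₚ-cong {p} {p} {q} {q′} (λ _ → refl)

*ₚ-congʳ : ∀ {p p′} q → p ≈ₚ p′ → p *ₚ q ≈ₚ p′ *ₚ q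
*ₚ-congʳ {p} {p′} q p≈p′ = *ₚ-cong {p} {p′} {q} {q} p≈p′ (λ _ → refl)

*ₚ-assoc : ∀ p q r → (p *ₚ q) *ₚ r ≈ₚ p *ₚ (q *ₚ r)
*ₚ-assoc p q r i = begin
  coeff ((p *ₚ q) *ₚ r) i                             ≡⟨ coeff-*ₚ (p *ₚ q) r i ⟩
  convolve (coeff (p *ₚ q)) (coeff r) i               ≡⟨ convolve-cong (coeff-*ₚ p q) (λ _ → refl) i ⟩
  convolve (convolve (coeff p) (coeff q)) (coeff r) i ≡⟨ convolve-assoc (coeff p) (coeff q) (coeff r) i ⟩
  convolve (coeff p) (convolve (coeff q) (coeff r)) i ≡⟨ convolve-cong (λ _ → refl) (coeff-*ₚ q r) i ⟨
  convolve (coeff p) (coeff (q *ₚ r)) i               ≡⟨ coeff-*ₚ p (q *ₚ r) i ⟨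
  coeff (p *ₚ (q *ₚ r)) i                             ∎
  where open ≡-Reasoning

*ₚ-identityˡ : ∀ p → 1ₚ *ₚ p ≈ₚ p
*ₚ-identityˡ p i =
  trans (coeff-*ₚ 1ₚ p i) (convolve-constantˡ {coeff 1ₚ} (coeff p) (λ _ → refl) i)

·ₚ-cong : ∀ c {p q} → p ≈ₚ q → c ·ₚ p ≈ₚ c ·ₚ q
·ₚ-cong c {p} {q} p≈q i =
  trans (coeff-·ₚ c p i) (trans (cong (c *_) (p≈q i)) (sym (coeff-·ₚ c q i)))

·ₚ-*ₚ-assoc : ∀ c p q → (c ·ₚ p) *ₚ q ≈ₚ c ·ₚ (p *ₚ q)
·ₚ-*ₚ-assoc c p q i = begin
  coeff ((c ·ₚ p) *ₚ q) i                          ≡⟨ coeff-*ₚ (c ·ₚ p) q i ⟩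
  convolve (coeff (c ·ₚ p)) (coeff q) i            ≡⟨ convolve-cong (coeff-·ₚ c p) (λ _ → refl) i ⟩
  convolve (λ k → c * coeff p k) (coeff q) i       ≡⟨ convolve-scaleˡ c (coeff p) (coeff q) i ⟩
  c * convolve (coeff p) (coeff q) i               ≡⟨ cong (c *_) (coeff-*ₚ p q i) ⟨
  c * coeff (p *ₚ q) i                             ≡⟨ coeff-·ₚ c (p *ₚ q) i ⟨
  coeff (c ·ₚ (p *ₚ q)) i                          ∎
  where open ≡-Reasoning

*ₚ-·ₚ-exchange : ∀ c p q → p *ₚ (c ·ₚ q) ≈ₚ c ·ₚ (p *ₚ q)
*ₚ-·ₚ-exchange c p q i = begin
  coeff (p *ₚ (c ·ₚ q)) i                          ≡⟨ coeff-*ₚ p (c ·ₚ q) i ⟩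
  convolve (coeff p) (coeff (c ·ₚ q)) i            ≡⟨ convolve-cong (λ _ → refl) (coeff-·ₚ c q) i ⟩
  convolve (coeff p) (λ k → c * coeff q k) i       ≡⟨ convolve-scaleʳ c (coeff p) (coeff q) i ⟩
  c * convolve (coeff p) (coeff q) i               ≡⟨ cong (c *_) (coeff-*ₚ p q i) ⟨
  c * coeff (p *ₚ q) i                             ≡⟨ coeff-·ₚ c (p *ₚ q) i ⟨
  coeff (c ·ₚ (p *ₚ q)) i                          ∎
  where open ≡-Reasoning

·ₚ-·ₚ : ∀ a b p → a ·ₚ (b ·ₚ p) ≈ₚ (a * b) ·ₚ p
·ₚ-·ₚ a b p i = begin
  coeff (a ·ₚ (b ·ₚ p)) i  ≡⟨ coeff-·ₚ a (b ·ₚ p) i ⟩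
  a * coeff (b ·ₚ p) i     ≡⟨ cong (a *_) (coeff-·ₚ b p i) ⟩
  a * (b * coeff p i)      ≡⟨ *-assoc a b _ ⟨
  a * b * coeff p i        ≡⟨ coeff-·ₚ (a * b) p i ⟨
  coeff ((a * b) ·ₚ p) i   ∎
  where open ≡-Reasoning

infixr 8 _^ₚ_
_^ₚ_ : Poly → ℕ → Poly
p ^ₚ zero  = 1ₚ
p ^ₚ suc n = p *ₚ (p ^ₚ n)

1+_X : 𝔽₄ → Poly
1+ t X = 1# ∷ t ∷ []

-- Degrees of products of linear factors

HasDegree-unique : ∀ {p q m n} → p ≈ₚ q → HasDegree p m → HasDegree q n → m ≡ n
HasDegree-unique {m = m} {n} p≈q (pm≢0 , p≡0) (qn≢0 , q≡0) = ℕ.≤-antisym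
  (ℕ.≮⇒≥ λ n<m → pm≢0 (trans (p≈q m) (q≡0 m n<m)))
  (ℕ.≮⇒≥ λ m<n → qn≢0 (trans (sym (p≈q n)) (p≡0 n m<n)))

coeff-linear-*ₚ : ∀ l q → Linear l → ∀ i →
  coeff (l *ₚ q) (suc i) ≡ coeff l 0 * coeff q (suc i) + coeff l 1 * coeff q i
coeff-linear-*ₚ l q (_ , l≡0) i =
  trans (coeff-*ₚ l q (suc i))
        (cong (coeff l 0 * coeff q (suc i) +_)
          (convolve-constantˡ (coeff q) (λ k → l≡0 (suc (suc k)) (s≤s (s≤s z≤n))) i))

linear-*ₚ-degree : ∀ {l q n} → Linear l → HasDegree q n → HasDegree (l *ₚ q) (suc n)
linear-*ₚ-degree {l} {q} {n} lin (qn≢0 , q≡0) = top , above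
  where
  open ≡-Reasoning
  top : coeff (l *ₚ q) (suc n) ≢ 0#
  top eq = *-≢0 (proj₁ lin) qn≢0 (begin
    coeff l 1 * coeff q n
      ≡⟨ cong (_+ coeff l 1 * coeff q n) (zeroʳ (coeff l 0)) ⟨
    coeff l 0 * 0# + coeff l 1 * coeff q n
      ≡⟨ cong (λ y → coeff l 0 * y + coeff l 1 * coeff q n) (q≡0 (suc n) (ℕ.n<1+n n)) ⟨
    coeff l 0 * coeff q (suc n) + coeff l 1 * coeff q n
      ≡⟨ coeff-linear-*ₚ l q lin n ⟨
    coeff (l *ₚ q) (suc n)
      ≡⟨ eq ⟩
    0# ∎)
  above : ∀ m → suc n < m → coeff (l *ₚ q) m ≡ 0#
  above (suc m) (s≤s n<m) = begin
    coeff (l *ₚ q) (suc m)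
      ≡⟨ coeff-linear-*ₚ l q lin m ⟩
    coeff l 0 * coeff q (suc m) + coeff l 1 * coeff q m
      ≡⟨ cong₂ (λ y z → coeff l 0 * y + coeff l 1 * z) (q≡0 (suc m) (ℕ.m<n⇒m<1+n n<m)) (q≡0 m n<m) ⟩
    coeff l 0 * 0# + coeff l 1 * 0#
      ≡⟨ cong₂ _+_ (zeroʳ (coeff l 0)) (zeroʳ (coeff l 1)) ⟩
    0# ∎

productₚ-degree : ∀ {ls} → All Linear ls → HasDegree (productₚ ls) (length ls)
productₚ-degree [] = (λ ()) , λ { (suc m) _ → refl }
productₚ-degree {l ∷ ls} (lin ∷ lins) =
  linear-*ₚ-degree {l} {productₚ ls} lin (productₚ-degree lins)

linear-normalise : ∀ l → Linear l → coeff l 0 ≢ 0# →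
  l ≈ₚ coeff l 0 ·ₚ 1+ (coeff l 0 ⁻¹ * coeff l 1) X
linear-normalise l lin l₀≢0 zero    = sym (*-identityʳ (coeff l 0))
linear-normalise l lin l₀≢0 (suc zero) = begin
  coeff l 1                               ≡⟨⟩
  1# * coeff l 1                          ≡⟨ cong (_* coeff l 1) (*-inverseʳ (coeff l 0) l₀≢0) ⟨
  coeff l 0 * coeff l 0 ⁻¹ * coeff l 1    ≡⟨ *-assoc (coeff l 0) _ _ ⟩
  coeff l 0 * (coeff l 0 ⁻¹ * coeff l 1)  ∎
  where open ≡-Reasoning
linear-normalise l (_ , l≡0) l₀≢0 (suc (suc i)) = l≡0 (suc (suc i)) (s≤s (s≤s z≤n))

-- Sections modulo 4

-- p(x⁴)
up : Poly → Poly
up []      = []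
up (a ∷ p) = a ∷ 0# ∷ 0# ∷ 0# ∷ up p

-- The part of `p` at exponents congruent to `j` mod 4, reindexed: `p` is the sum over `j` of x^j
-- times `up (section j p)`.
section : Fin 4 → Poly → Poly
section j  []      = []
section 0F (a ∷ p) = a ∷ section 3F p
section 1F (a ∷ p) = section 0F p
section 2F (a ∷ p) = section 1F p
section 3F (a ∷ p) = section 2F p

coeff-section : ∀ j p i → coeff (section j p) i ≡ coeff p (toℕ j ℕ.+ i ℕ.* 4)
coeff-section j  []      i       = refl
coeff-section 0F (a ∷ p) zero    = refl
coeff-section 0F (a ∷ p) (suc i) = coeff-section 3F p i
coeff-section 1F (a ∷ p) i       = coeff-section 0F p i
coeff-section 2F (a ∷ p) i       = coeff-section 1F p i
coeff-section 3F (a ∷ p) i       = coeff-section 2F p i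

coeff-up-multiple : ∀ p i → coeff (up p) (i ℕ.* 4) ≡ coeff p i
coeff-up-multiple []      i       = refl
coeff-up-multiple (a ∷ p) zero    = refl
coeff-up-multiple (a ∷ p) (suc i) = coeff-up-multiple p i

coeff-up-nonmultiple : ∀ (j : Fin 3) p i → coeff (up p) (suc (toℕ j) ℕ.+ i ℕ.* 4) ≡ 0#
coeff-up-nonmultiple j  []      i       = refl
coeff-up-nonmultiple 0F (a ∷ p) zero    = refl
coeff-up-nonmultiple 1F (a ∷ p) zero    = refl
coeff-up-nonmultiple 2F (a ∷ p) zero    = refl
coeff-up-nonmultiple 0F (a ∷ p) (suc i) = coeff-up-nonmultiple 0F p i
coeff-up-nonmultiple 1F (a ∷ p) (suc i) = coeff-up-nonmultiple 1F p i
coeff-up-nonmultiple 2F (a ∷ p) (suc i) = coeff-up-nonmultiple 2F p i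

-- Multiplication by a polynomial in x⁴ mixes no residue classes mod 4, so taking a section commutes
-- with it. This passes from the coefficients of f to those of R · P.
coeff-*ₚ-up : ∀ j p q i →
  coeff (p *ₚ up q) (toℕ j ℕ.+ i ℕ.* 4) ≡ coeff (section j p *ₚ q) i
coeff-*ₚ-up j  []      q i       = refl
coeff-*ₚ-up 0F (a ∷ p) q zero    = begin
  coeff ((a ∷ p) *ₚ up q) 0          ≡⟨ coeff-*ₚ-zero a p (up q) ⟩
  a * coeff (up q) 0                 ≡⟨ cong (a *_) (coeff-up-multiple q 0) ⟩
  a * coeff q 0                      ≡⟨ coeff-*ₚ-zero a (section 3F p) q ⟨
  coeff ((a ∷ section 3F p) *ₚ q) 0  ∎
  where open ≡-Reasoning
coeff-*ₚ-up 0F (a ∷ p) q (suc i) = begin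
  coeff ((a ∷ p) *ₚ up q) (suc i ℕ.* 4)
    ≡⟨ coeff-*ₚ-suc a p (up q) (3 ℕ.+ i ℕ.* 4) ⟩
  a * coeff (up q) (suc i ℕ.* 4) + coeff (p *ₚ up q) (3 ℕ.+ i ℕ.* 4)
    ≡⟨ cong₂ (λ y z → a * y + z) (coeff-up-multiple q (suc i)) (coeff-*ₚ-up 3F p q i) ⟩
  a * coeff q (suc i) + coeff (section 3F p *ₚ q) i
    ≡⟨ coeff-*ₚ-suc a (section 3F p) q i ⟨
  coeff ((a ∷ section 3F p) *ₚ q) (suc i) ∎
  where open ≡-Reasoning
coeff-*ₚ-up (Fin.suc j) (a ∷ p) q i = begin
  coeff ((a ∷ p) *ₚ up q) (suc k)
    ≡⟨ coeff-*ₚ-suc a p (up q) k ⟩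
  a * coeff (up q) (suc k) + coeff (p *ₚ up q) k
    ≡⟨ cong (λ y → a * y + coeff (p *ₚ up q) k) (coeff-up-nonmultiple j q i) ⟩
  a * 0# + coeff (p *ₚ up q) k
    ≡⟨ cong (_+ coeff (p *ₚ up q) k) (zeroʳ a) ⟩
  coeff (p *ₚ up q) k
    ≡⟨ shift j ⟩
  coeff (section (Fin.suc j) (a ∷ p) *ₚ q) i ∎
  where
  open ≡-Reasoning
  k : ℕ
  k = toℕ j ℕ.+ i ℕ.* 4
  -- Splitting on `j` lets `section` reduce and replaces the index in `Fin 3` by the one in `Fin 4`
  -- of equal value.
  shift : ∀ j → coeff (p *ₚ up q) (toℕ j ℕ.+ i ℕ.* 4) ≡ coeff (section (Fin.suc j) (a ∷ p) *ₚ q) i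
  shift 0F = coeff-*ₚ-up 0F p q i
  shift 1F = coeff-*ₚ-up 1F p q i
  shift 2F = coeff-*ₚ-up 2F p q i

≈ₚ-residues : ∀ {p q} →
  (∀ (j : Fin 4) i → coeff p (toℕ j ℕ.+ i ℕ.* 4) ≡ coeff q (toℕ j ℕ.+ i ℕ.* 4)) → p ≈ₚ q
≈ₚ-residues {p} {q} eq n = subst (λ m → coeff p m ≡ coeff q m) (sym property) (eq remainder quotient)
  where open DivMod (n divMod 4)

up-cong : ∀ {p q} → p ≈ₚ q → up p ≈ₚ up q
up-cong {p} {q} p≈q = ≈ₚ-residues {up p} {up q} λ where
  0F          i → trans (coeff-up-multiple p i) (trans (p≈q i) (sym (coeff-up-multiple q i)))
  (Fin.suc j) i → trans (coeff-up-nonmultiple j p i) (sym (coeff-up-nonmultiple j q i))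

-- Among the sections of `up p`, the one at 0 is `p` and the others vanish, so `coeff-*ₚ-up`
-- computes the product on every residue class.
up-*ₚ : ∀ p q → up p *ₚ up q ≈ₚ up (p *ₚ q)
up-*ₚ p q = ≈ₚ-residues {up p *ₚ up q} {up (p *ₚ q)} residue
  where
  open ≡-Reasoning
  section≈p : section 0F (up p) ≈ₚ p
  section≈p k = trans (coeff-section 0F (up p) k) (coeff-up-multiple p k)
  section≈[] : ∀ j → section (Fin.suc j) (up p) ≈ₚ []
  section≈[] j k = trans (coeff-section (Fin.suc j) (up p) k) (coeff-up-nonmultiple j p k)
  residue : ∀ (j : Fin 4) i →
    coeff (up p *ₚ up q) (toℕ j ℕ.+ i ℕ.* 4) ≡ coeff (up (p *ₚ q)) (toℕ j ℕ.+ i ℕ.* 4)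
  residue 0F i = begin
    coeff (up p *ₚ up q) (i ℕ.* 4)    ≡⟨ coeff-*ₚ-up 0F (up p) q i ⟩
    coeff (section 0F (up p) *ₚ q) i  ≡⟨ *ₚ-congʳ {section 0F (up p)} {p} q section≈p i ⟩
    coeff (p *ₚ q) i                  ≡⟨ coeff-up-multiple (p *ₚ q) i ⟨
    coeff (up (p *ₚ q)) (i ℕ.* 4)     ∎
  residue (Fin.suc j) i = begin
    coeff (up p *ₚ up q) (suc (toℕ j) ℕ.+ i ℕ.* 4)
      ≡⟨ coeff-*ₚ-up (Fin.suc j) (up p) q i ⟩
    coeff (section (Fin.suc j) (up p) *ₚ q) i
      ≡⟨ *ₚ-congʳ {section (Fin.suc j) (up p)} {[]} q (section≈[] j) i ⟩
    0#
      ≡⟨ coeff-up-nonmultiple j (p *ₚ q) i ⟨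
    coeff (up (p *ₚ q)) (suc (toℕ j) ℕ.+ i ℕ.* 4) ∎

-- Products of linear factors as words in base 4 digits of exponents

Letter : Set
Letter = Fin 4 × Fin 4 × Fin 4

allLetters? : ∀ {p} {P : Letter → Set p} → (∀ l → Dec (P l)) → Dec (∀ l → P l)
allLetters? P? = map′ (λ { f (a , b , c) → f a b c }) (λ f a b c → f (a , b , c))
  (Fin.all? λ a → Fin.all? λ b → Fin.all? λ c → P? (a , b , c))

letterPoly : Letter → Poly
letterPoly (a , b , c) =
  1+ 1# X ^ₚ toℕ a *ₚ (1+ ω X ^ₚ toℕ b *ₚ 1+ ω² X ^ₚ toℕ c)

size : Letter → ℕ
size (a , b , c) = toℕ a ℕ.+ (toℕ b ℕ.+ toℕ c)

Word : Set
Word = List Letter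

-- Lowest digits come first. As s⁴ = s in `𝔽₄`, the power (1 + s x)^(4m) is (1 + s x)^m with x⁴ put
-- for x, which is why the higher digits appear under `up`.
wordPoly : Word → Poly
wordPoly []      = 1ₚ
wordPoly (l ∷ w) = letterPoly l *ₚ up (wordPoly w)

degree : Word → ℕ
degree []      = 0
degree (l ∷ w) = size l ℕ.+ degree w ℕ.* 4

increment : Fin 4 → Bool × Fin 4
increment 0F = false , 1F
increment 1F = false , 2F
increment 2F = false , 3F
increment 3F = true  , 0F

-- The Boolean says whether a factor (1 + s x)⁴ = up (1+ s X) is carried over;
-- for s = 0# the value is junk.
absorb : 𝔽₄ → Letter → Bool × Letter
absorb 0# l           = false , l
absorb 1# (a , b , c) = let k , a′ = increment a in k , a′ , b , c
absorb ω  (a , b , c) = let k , b′ = increment b in k , a , b′ , c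
absorb ω² (a , b , c) = let k , c′ = increment c in k , a , b , c′

emptyLetter : Letter
emptyLetter = 0F , 0F , 0F

times : 𝔽₄ → Word → Word
times s []      = proj₂ (absorb s emptyLetter) ∷ []
times s (l ∷ w) =
  proj₂ (absorb s l) ∷ (if proj₁ (absorb s l) then times s w else w)

-- An overflowing digit yields (1 + s x)⁴ = 1 + s⁴ x⁴ = 1 + s x⁴, of degree 4, by characteristic 2
-- and s⁴ = s. The three values of s and the 64 letters are checked by evaluation.
absorb-letterPoly : ∀ s → s ≢ 0# → ∀ l →
  let k , l′ = absorb s l in
  1+ s X *ₚ letterPoly l ≈ₚ letterPoly l′ *ₚ (if k then up (1+ s X) else 1ₚ) ×
  suc (size l) ≡ size l′ ℕ.+ (if k then 4 else 0)
absorb-letterPoly = from-yes (all? λ s → ¬? (s ≟ 0#) →-dec allLetters? λ l →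
  let k , l′ = absorb s l in
  1+ s X *ₚ letterPoly l ≈? letterPoly l′ *ₚ (if k then up (1+ s X) else 1ₚ) ×-dec
  suc (size l) ℕ.≟ size l′ ℕ.+ (if k then 4 else 0))

wordPoly-times : ∀ s → s ≢ 0# → ∀ w → wordPoly (times s w) ≈ₚ 1+ s X *ₚ wordPoly w
wordPoly-times s s≢0 [] = unit s s≢0
  where
  unit : ∀ s → s ≢ 0# → wordPoly (times s []) ≈ₚ 1+ s X *ₚ 1ₚ
  unit = from-yes (all? λ s → ¬? (s ≟ 0#) →-dec wordPoly (times s []) ≈? 1+ s X *ₚ 1ₚ)
wordPoly-times s s≢0 (l ∷ w) = begin
  letterPoly l′ *ₚ up (wordPoly (if k then times s w else w))
    ≈⟨ *ₚ-congˡ (letterPoly l′) {carried k *ₚ up (wordPoly w)} (carry k) ⟨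
  letterPoly l′ *ₚ (carried k *ₚ up (wordPoly w))
    ≈⟨ *ₚ-assoc (letterPoly l′) (carried k) (up (wordPoly w)) ⟨
  (letterPoly l′ *ₚ carried k) *ₚ up (wordPoly w)
    ≈⟨ *ₚ-congʳ {1+ s X *ₚ letterPoly l} {letterPoly l′ *ₚ carried k} (up (wordPoly w))
         (proj₁ (absorb-letterPoly s s≢0 l)) ⟨
  (1+ s X *ₚ letterPoly l) *ₚ up (wordPoly w)
    ≈⟨ *ₚ-assoc (1+ s X) (letterPoly l) (up (wordPoly w)) ⟩
  1+ s X *ₚ (letterPoly l *ₚ up (wordPoly w))
    ∎
  where
  open SetoidReasoning ≈ₚ-setoid
  k : Bool
  k = proj₁ (absorb s l)
  l′ : Letter
  l′ = proj₂ (absorb s l)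
  carried : Bool → Poly
  carried k = if k then up (1+ s X) else 1ₚ
  carry : ∀ k → carried k *ₚ up (wordPoly w) ≈ₚ up (wordPoly (if k then times s w else w))
  carry false = *ₚ-identityˡ (up (wordPoly w))
  carry true  = begin
    up (1+ s X) *ₚ up (wordPoly w)
      ≈⟨ up-*ₚ (1+ s X) (wordPoly w) ⟩
    up (1+ s X *ₚ wordPoly w)
      ≈⟨ up-cong {wordPoly (times s w)} {1+ s X *ₚ wordPoly w} (wordPoly-times s s≢0 w) ⟨
    up (wordPoly (times s w))
      ∎

degree-times : ∀ s → s ≢ 0# → ∀ w → degree (times s w) ≡ suc (degree w)
degree-times s s≢0 [] = unit s s≢0
  where
  unit : ∀ s → s ≢ 0# → degree (times s []) ≡ 1
  unit = from-yes (all? λ s → ¬? (s ≟ 0#) →-dec degree (times s []) ℕ.≟ 1)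
degree-times s s≢0 (l ∷ w) =
  shift (proj₁ (absorb s l)) (proj₂ (absorb-letterPoly s s≢0 l))
  where
  open ≡-Reasoning
  shift : ∀ k {m} → suc (size l) ≡ m ℕ.+ (if k then 4 else 0) →
    m ℕ.+ degree (if k then times s w else w) ℕ.* 4 ≡ suc (degree (l ∷ w))
  shift false {m} eq = cong (ℕ._+ degree w ℕ.* 4) (sym (trans eq (ℕ.+-identityʳ m)))
  shift true  {m} eq = begin
    m ℕ.+ degree (times s w) ℕ.* 4      ≡⟨ cong (λ d → m ℕ.+ d ℕ.* 4) (degree-times s s≢0 w) ⟩
    m ℕ.+ (4 ℕ.+ degree w ℕ.* 4)        ≡⟨ ℕ.+-assoc m 4 _ ⟨
    m ℕ.+ 4 ℕ.+ degree w ℕ.* 4          ≡⟨ cong (ℕ._+ degree w ℕ.* 4) eq ⟨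
    suc (size l) ℕ.+ degree w ℕ.* 4     ∎

-- A nonzero constant term excludes multiples of x among the factors. Every other linear factor is a
-- constant times some `1+ s X` with s ≠ 0, which `times` adds to the word.
productₚ-word : ∀ {ls} → All Linear ls → coeff (productₚ ls) 0 ≢ 0# →
  ∃[ w ] ∃[ c ] productₚ ls ≈ₚ c ·ₚ wordPoly w × degree w ≡ length ls
productₚ-word [] _ = [] , 1# , (λ _ → refl) , refl
productₚ-word {l ∷ ls} (lin ∷ lins) nonzero =
  let w , c , eq , deg = productₚ-word lins p₀≢0 in
  times s w , a * c , factorise w c eq , trans (degree-times s s≢0 w) (cong suc deg)
  where
  p : Poly
  p = productₚ ls
  a s : 𝔽₄
  a = coeff l 0
  s = a ⁻¹ * coeff l 1
  a*p₀≢0 : a * coeff p 0 ≢ 0#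
  a*p₀≢0 eq = nonzero (trans (coeff-*ₚ l p 0) eq)
  a≢0 : a ≢ 0#
  a≢0 eq = a*p₀≢0 (cong (_* coeff p 0) eq)
  p₀≢0 : coeff p 0 ≢ 0#
  p₀≢0 eq = a*p₀≢0 (trans (cong (a *_) eq) (zeroʳ a))
  s≢0 : s ≢ 0#
  s≢0 s≡0 = proj₁ lin (trans (linear-normalise l lin a≢0 1) (trans (cong (a *_) s≡0) (zeroʳ a)))
  factorise : ∀ w c → p ≈ₚ c ·ₚ wordPoly w → l *ₚ p ≈ₚ (a * c) ·ₚ wordPoly (times s w)
  factorise w c eq = begin
    l *ₚ p
      ≈⟨ *ₚ-cong {l} {a ·ₚ 1+ s X} {p} {c ·ₚ wordPoly w} (linear-normalise l lin a≢0) eq ⟩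
    (a ·ₚ 1+ s X) *ₚ (c ·ₚ wordPoly w)
      ≈⟨ ·ₚ-*ₚ-assoc a (1+ s X) (c ·ₚ wordPoly w) ⟩
    a ·ₚ (1+ s X *ₚ (c ·ₚ wordPoly w))
      ≈⟨ ·ₚ-cong a {1+ s X *ₚ (c ·ₚ wordPoly w)} {c ·ₚ (1+ s X *ₚ wordPoly w)}
           (*ₚ-·ₚ-exchange c (1+ s X) (wordPoly w)) ⟩
    a ·ₚ (c ·ₚ (1+ s X *ₚ wordPoly w))
      ≈⟨ ·ₚ-·ₚ a c (1+ s X *ₚ wordPoly w) ⟩
    (a * c) ·ₚ (1+ s X *ₚ wordPoly w)
      ≈⟨ ·ₚ-cong (a * c) {wordPoly (times s w)} {1+ s X *ₚ wordPoly w} (wordPoly-times s s≢0 w) ⟨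
    (a * c) ·ₚ wordPoly (times s w)
      ∎
    where open SetoidReasoning ≈ₚ-setoid

-- Requirements on words

-- In a requirement (q , d), d is the intended value of 1 + deg q.
Requirement : Set
Requirement = Poly × ℕ

Satisfies : Word → Requirement → Set
Satisfies w (q , d) = ∀ i → i < d ℕ.+ degree w → coeff (q *ₚ wordPoly w) i ≢ 0#

-- Fullness of P together with `T` ⊆ T(P); `T` may be a proper subset of T(P).
requirements : List 𝔽₄ → List Requirement
requirements T = (1ₚ , 1) ∷ map (λ t → 1+ t X , 2) T

-- The quotient is (d + size l - j) / 4 rounded up: the number of i for which j + 4i is below d +
-- size l.
sections : Letter → Requirement → List Requirement
sections l (q , d) =
  map (λ j → section j (q *ₚ letterPoly l) , (d ℕ.+ size l ℕ.+ (3 ∸ toℕ j)) / 4)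
      (allFin 4)

section-index : ∀ {i e} x D (j : Fin 4) → e ℕ.* 4 ≤ x ℕ.+ (3 ∸ toℕ j) →
  i < e ℕ.+ D → toℕ j ℕ.+ i ℕ.* 4 < x ℕ.+ D ℕ.* 4
-- Adding 3 to both sides absorbs the rounding, since j and `3 ∸ toℕ j` sum to 3.
section-index {i} {e} x D j e≤ i< = ℕ.+-cancelˡ-≤ 3 _ _ (begin
  3 ℕ.+ suc (toℕ j ℕ.+ i ℕ.* 4)                     ≡⟨ ring₁ (toℕ j) i ⟩
  toℕ j ℕ.+ suc i ℕ.* 4                             ≤⟨ ℕ.+-monoʳ-≤ (toℕ j) (ℕ.*-monoˡ-≤ 4 i<) ⟩
  toℕ j ℕ.+ (e ℕ.+ D) ℕ.* 4                         ≡⟨ cong (toℕ j ℕ.+_) (ℕ.*-distribʳ-+ 4 e D) ⟩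
  toℕ j ℕ.+ (e ℕ.* 4 ℕ.+ D ℕ.* 4)                   ≤⟨ ℕ.+-monoʳ-≤ (toℕ j) (ℕ.+-monoˡ-≤ (D ℕ.* 4) e≤) ⟩
  toℕ j ℕ.+ (x ℕ.+ (3 ∸ toℕ j) ℕ.+ D ℕ.* 4)         ≡⟨ ring₂ (toℕ j) x (3 ∸ toℕ j) D ⟩
  toℕ j ℕ.+ (3 ∸ toℕ j) ℕ.+ (x ℕ.+ D ℕ.* 4)         ≡⟨ cong (ℕ._+ (x ℕ.+ D ℕ.* 4)) (ℕ.m+[n∸m]≡n (ℕ.≤-pred (Fin.toℕ<n j))) ⟩
  3 ℕ.+ (x ℕ.+ D ℕ.* 4)                             ∎)
  where
  open ℕ.≤-Reasoning
  ring₁ : ∀ j i → 3 ℕ.+ suc (j ℕ.+ i ℕ.* 4) ≡ j ℕ.+ suc i ℕ.* 4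
  ring₁ = solve-∀
  ring₂ : ∀ j x y D → j ℕ.+ (x ℕ.+ y ℕ.+ D ℕ.* 4) ≡ j ℕ.+ y ℕ.+ (x ℕ.+ D ℕ.* 4)
  ring₂ = solve-∀

satisfies-sections : ∀ l w r → Satisfies (l ∷ w) r → All (Satisfies w) (sections l r)
satisfies-sections l w (q , d) sat = 
  All.map⁺ {f = λ j → section j (q *ₚ letterPoly l) , (d ℕ.+ size l ℕ.+ (3 ∸ toℕ j)) / 4}
           (All.universal satisfies-section (allFin 4))
  where
  satisfies-section : ∀ j → Satisfies w
    (section j (q *ₚ letterPoly l) , (d ℕ.+ size l ℕ.+ (3 ∸ toℕ j)) / 4)
  satisfies-section j i i< eq =
    sat (toℕ j ℕ.+ i ℕ.* 4)
        (subst (toℕ j ℕ.+ i ℕ.* 4 <_) (ℕ.+-assoc d (size l) _)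
          (section-index (d ℕ.+ size l) (degree w) j (m/n*n≤m _ 4) i<))
        (begin
          coeff (q *ₚ (letterPoly l *ₚ up (wordPoly w))) (toℕ j ℕ.+ i ℕ.* 4)
            ≡⟨ *ₚ-assoc q (letterPoly l) _ (toℕ j ℕ.+ i ℕ.* 4) ⟨
          coeff ((q *ₚ letterPoly l) *ₚ up (wordPoly w)) (toℕ j ℕ.+ i ℕ.* 4)
            ≡⟨ coeff-*ₚ-up j (q *ₚ letterPoly l) (wordPoly w) i ⟩
          coeff (section j (q *ₚ letterPoly l) *ₚ wordPoly w) i
            ≡⟨ eq ⟩
          0# ∎)
    where open ≡-Reasoning

satisfies-cong : ∀ {w w′} → wordPoly w ≈ₚ wordPoly w′ → degree w ≡ degree w′ →
  ∀ {r} → Satisfies w r → Satisfies w′ r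
satisfies-cong {w} {w′} p≈p′ deg {q , d} sat i i< eq =
  sat i (subst (λ n → i < d ℕ.+ n) (sym deg) i<) (trans (*ₚ-congˡ q {wordPoly w} {wordPoly w′} p≈p′ i) eq)

-- The product of `r` with the word also has constant term zero, so index 0 must lie outside the
-- required range. This rules out e > 0 and forces P to be constant.
satisfies-vanishing : ∀ w ((r , e) : Requirement) →
  Satisfies w (r , e) → coeff r 0 ≡ 0# → e ℕ.+ degree w ≡ 0
satisfies-vanishing w (r , e) sat r₀≡0 = ℕ.n<1⇒n≡0 (s≤s (ℕ.≮⇒≥ λ 0< →
  sat 0 0< (trans (coeff-*ₚ r (wordPoly w) 0) (cong (_* coeff (wordPoly w) 0) r₀≡0))))

infix 4 _Implies_ _implies?_
-- The polynomials in `requirements` have constant term 1, so `coeff r 0` is the only possible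
-- scalar.
_Implies_ : Requirement → Requirement → Set
(r , e) Implies (q , d) = d ≤ e × r ≈ₚ coeff r 0 ·ₚ q

_implies?_ : Binary.Decidable _Implies_
(r , e) implies? (q , d) = d ℕ.≤? e ×-dec r ≈? coeff r 0 ·ₚ q

satisfies-implied : ∀ {w r s} → Satisfies w r → r Implies s → Satisfies w s
satisfies-implied {w} {r , e} {q , d} sat (d≤e , r≈) i i< eq =
  sat i (ℕ.<-≤-trans i< (ℕ.+-monoˡ-≤ (degree w) d≤e)) (begin
    coeff (r *ₚ wordPoly w) i                     ≡⟨ *ₚ-congʳ {r} {coeff r 0 ·ₚ q} (wordPoly w) r≈ i ⟩
    coeff ((coeff r 0 ·ₚ q) *ₚ wordPoly w) i      ≡⟨ ·ₚ-*ₚ-assoc (coeff r 0) q (wordPoly w) i ⟩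
    coeff (coeff r 0 ·ₚ (q *ₚ wordPoly w)) i      ≡⟨ coeff-·ₚ (coeff r 0) (q *ₚ wordPoly w) i ⟩
    coeff r 0 * coeff (q *ₚ wordPoly w) i         ≡⟨ cong (coeff r 0 *_) eq ⟩
    coeff r 0 * 0#                                ≡⟨ zeroʳ (coeff r 0) ⟩
    0#                                            ∎)
  where open ≡-Reasoning

-- The finite check

nonzero? : ∀ (d : Fin 4) → Dec (d ≢ Fin.zero)
nonzero? d = ¬? (d Fin.≟ Fin.zero)

countNonzero : List (Fin 4) → ℕ
countNonzero = length ∘ filter nonzero?

-- Taken from 1 + size because deg f + 1 = (size l + 1) + 4 deg P. Removing the last digit leaves
-- `carry l` + deg P, which for carry 1 is again deg P + 1.
digit : Letter → Fin 4
digit l = suc (size l) mod 4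

carry : Letter → ℕ
carry l = suc (size l) / 4

-- The eight subsets of the nonzero elements, listed without repetition so that `length` is
-- cardinality.
unitSubsets : List (List 𝔽₄)
unitSubsets =
    (1# ∷ ω ∷ ω² ∷ []) ∷ (1# ∷ ω ∷ []) ∷ (1# ∷ ω² ∷ []) ∷ (ω ∷ ω² ∷ [])
  ∷ (1# ∷ []) ∷ (ω ∷ []) ∷ (ω² ∷ []) ∷ [] ∷ []

Impossible Stops : List Requirement → Set
Impossible = Any λ (r , e) → 0 < e × coeff r 0 ≡ 0#
Stops      = Any λ (r , e) → coeff r 0 ≡ 0#

-- By `satisfies-vanishing`, the first case is contradictory and the second makes P constant,
-- leaving a single digit to add to the length of `T`. In the third, the growth from `T` to `T′`
-- pays for the digit removed.
Outcome : List 𝔽₄ → Letter → Set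
Outcome T l =
    Impossible S
  ⊎ (Stops S × carry l ≡ 0 × length T ≤ 3)
  ⊎ (carry l ≡ 1 ×
     Any (λ T′ → countNonzero (digit l ∷ []) ℕ.+ length T ≤ length T′ ×
                 All (λ r → Any (_Implies r) S) (requirements T′))
         unitSubsets)
  where
  S : List Requirement
  S = concatMap (sections l) (requirements T)

outcome? : ∀ T l → Dec (Outcome T l)
outcome? T l =
  Any.any? (λ (r , e) → 0 ℕ.<? e ×-dec coeff r 0 ≟ 0#) _
  ⊎-dec (Any.any? (λ (r , _) → coeff r 0 ≟ 0#) _ ×-dec carry l ℕ.≟ 0 ×-dec length T ℕ.≤? 3)
  ⊎-dec (carry l ℕ.≟ 1 ×-dec
         Any.any? (λ T′ → _ ℕ.≤? _ ×-dec
                          All.all? (λ r → Any.any? (_implies? r) _) (requirements T′))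
                  unitSubsets)

outcome : All (λ T → ∀ l → Outcome T l) unitSubsets
outcome = from-yes (All.all? (λ T → allLetters? (outcome? T)) unitSubsets)

-- Counting digits

countNonzero-∷ : ∀ d ds → countNonzero (d ∷ ds) ≡ countNonzero (d ∷ []) ℕ.+ countNonzero ds
countNonzero-∷ d ds = trans
  (cong length (List.filter-++ nonzero? (d ∷ []) ds))
  (List.length-++ (filter nonzero? (d ∷ [])))

digits-unique : ∀ {c d : Fin 4} {m n} →
  toℕ c ℕ.+ m ℕ.* 4 ≡ toℕ d ℕ.+ n ℕ.* 4 → c ≡ d × m ≡ n
digits-unique {c} {d} {m} {n} eq = c≡d ,
  ℕ.*-cancelʳ-≡ m n 4 (ℕ.+-cancelˡ-≡ (toℕ d) _ _
    (trans (cong (λ c → toℕ c ℕ.+ m ℕ.* 4) (sym c≡d)) eq))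
  where
  residue : ∀ (c : Fin 4) m → (toℕ c ℕ.+ m ℕ.* 4) % 4 ≡ toℕ c
  residue c m = trans ([m+kn]%n≡m%n (toℕ c) m 4) (m<n⇒m%n≡m (Fin.toℕ<n c))
  c≡d : c ≡ d
  c≡d = Fin.toℕ-injective (trans (sym (residue c m)) (trans (cong (_% 4) eq) (residue d n)))

countNonzero-zero : ∀ ds → fromDigits ds ≡ 0 → countNonzero ds ≡ 0
countNonzero-zero []       _  = refl
countNonzero-zero (d ∷ ds) eq with digits-unique {d} {0F} {fromDigits ds} {0} eq
... | refl , eq′ = countNonzero-zero ds eq′

-- The empty word is padded with a zero letter, so that the induction on digits always has a letter
-- to remove.
uncons : ∀ w → ∃[ l ] ∃[ w′ ] wordPoly w ≈ₚ wordPoly (l ∷ w′) × degree w ≡ degree (l ∷ w′)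
uncons (l ∷ w) = l , w , (λ _ → refl) , refl
uncons []      = emptyLetter , [] , from-yes (wordPoly [] ≈? wordPoly (emptyLetter ∷ [])) , refl

-- Induction on the digits, with the size of `T` as the quantity that grows. The list may end in
-- zeros, but it is nonempty, since `[]` represents 0.
countNonzero-bound : ∀ ds w T → T ∈ unitSubsets → All (Satisfies w) (requirements T) →
  fromDigits ds ≡ suc (degree w) → countNonzero ds ℕ.+ length T ≤ 4
countNonzero-bound (d ∷ ds) w₀ T T∈ sat₀ eq₀ with uncons w₀
... | l , w , w₀≈ , deg = bound (All.lookup outcome T∈ l)
  where
  S : List Requirement
  S = concatMap (sections l) (requirements T)
  sat : All (Satisfies w) S
  sat = All.concat⁺ (All.map⁺ (All.map
    (λ {r} → satisfies-sections l w r ∘ satisfies-cong {w₀} {l ∷ w} w₀≈ deg {r}) sat₀))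
  eq : toℕ d ℕ.+ fromDigits ds ℕ.* 4 ≡ toℕ (digit l) ℕ.+ (carry l ℕ.+ degree w) ℕ.* 4
  eq = begin
    toℕ d ℕ.+ fromDigits ds ℕ.* 4                           ≡⟨ trans eq₀ (cong suc deg) ⟩
    suc (size l) ℕ.+ degree w ℕ.* 4                         ≡⟨ cong (ℕ._+ degree w ℕ.* 4) (DivMod.property (suc (size l) divMod 4)) ⟩
    toℕ (digit l) ℕ.+ carry l ℕ.* 4 ℕ.+ degree w ℕ.* 4      ≡⟨ ℕ.+-assoc (toℕ (digit l)) _ _ ⟩
    toℕ (digit l) ℕ.+ (carry l ℕ.* 4 ℕ.+ degree w ℕ.* 4)    ≡⟨ cong (toℕ (digit l) ℕ.+_) (ℕ.*-distribʳ-+ 4 (carry l) (degree w)) ⟨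
    toℕ (digit l) ℕ.+ (carry l ℕ.+ degree w) ℕ.* 4          ∎
    where open ≡-Reasoning
  d≡ : d ≡ digit l
  d≡ = proj₁ (digits-unique {m = fromDigits ds} {carry l ℕ.+ degree w} eq)
  ds≡ : fromDigits ds ≡ carry l ℕ.+ degree w
  ds≡ = proj₂ (digits-unique {d} {digit l} eq)
  open ℕ.≤-Reasoning
  bound : Outcome T l → countNonzero (d ∷ ds) ℕ.+ length T ≤ 4
  bound (inj₁ impossible) =
    let sat-r , 0<e , r₀≡0 = All.lookupAny sat impossible in
    contradiction (ℕ.m+n≡0⇒m≡0 _ (satisfies-vanishing w (Any.lookup impossible) sat-r r₀≡0)) (ℕ.m<n⇒n≢0 0<e)
  bound (inj₂ (inj₁ (stops , carry≡0 , T≤3))) =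
    -- P is constant and nothing is carried, so the remaining digits represent 0 and are all zero.
    let sat-r , r₀≡0 = All.lookupAny sat stops
        degree≡0 = ℕ.m+n≡0⇒n≡0 _ (satisfies-vanishing w (Any.lookup stops) sat-r r₀≡0)
    in begin
    countNonzero (d ∷ ds) ℕ.+ length T                        ≡⟨ cong (ℕ._+ length T) (countNonzero-∷ d ds) ⟩
    countNonzero (d ∷ []) ℕ.+ countNonzero ds ℕ.+ length T    ≡⟨ cong (λ n → countNonzero (d ∷ []) ℕ.+ n ℕ.+ length T)
                                                                   (countNonzero-zero ds (trans ds≡ (cong₂ ℕ._+_ carry≡0 degree≡0))) ⟩
    countNonzero (d ∷ []) ℕ.+ 0 ℕ.+ length T                  ≤⟨ ℕ.+-mono-≤ (ℕ.+-monoˡ-≤ 0 (List.length-filter nonzero? (d ∷ []))) T≤3 ⟩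
    4                                                         ∎
  bound (inj₂ (inj₂ (carry≡1 , progress))) =
    -- Pairing `progress` with the list of all membership proofs recovers `T′ ∈ unitSubsets` for the
    -- subset found.
    let T′∈ , grows , implied = All.lookupAny (All.tabulate {xs = unitSubsets} (λ T′∈ → T′∈)) progress
        T′ = Any.lookup progress
    in begin
    countNonzero (d ∷ ds) ℕ.+ length T                               ≡⟨ cong (ℕ._+ length T) (countNonzero-∷ d ds) ⟩
    countNonzero (d ∷ []) ℕ.+ countNonzero ds ℕ.+ length T           ≡⟨ cong (ℕ._+ length T) (ℕ.+-comm (countNonzero (d ∷ [])) _) ⟩
    countNonzero ds ℕ.+ countNonzero (d ∷ []) ℕ.+ length T           ≡⟨ ℕ.+-assoc (countNonzero ds) _ _ ⟩
    countNonzero ds ℕ.+ (countNonzero (d ∷ []) ℕ.+ length T)         ≡⟨ cong (λ d → countNonzero ds ℕ.+ (countNonzero (d ∷ []) ℕ.+ length T)) d≡ ⟩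
    countNonzero ds ℕ.+ (countNonzero (digit l ∷ []) ℕ.+ length T)   ≤⟨ ℕ.+-monoʳ-≤ (countNonzero ds) grows ⟩
    countNonzero ds ℕ.+ length T′                                    ≤⟨ countNonzero-bound ds w T′ T′∈
                                                                          (All.map (λ {r} any → let sat-s , s⇒r = All.lookupAny sat any in
                                                                             satisfies-implied {w} {Any.lookup any} {r} sat-s s⇒r) implied)
                                                                          (trans ds≡ (cong (ℕ._+ degree w) carry≡1)) ⟩
    4                                                                ∎

-- The bound for polynomials, and an example of degree 100

digits-bound : ∀ (f : Poly) (n : ℕ) → HasDegree f n → IsProductOfLinearFactors f →
  AllCoefficientsNonzeroUpTo n f → nonzeroDigits₄ (suc n) ≤ 4
digits-bound f n f-degree (ls , linear , f≈) nonzero =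
  let w , c , ls≈ , degree≡ = productₚ-word linear (λ eq → nonzero 0 z≤n (trans (f≈ 0) eq))
      n≡ : n ≡ degree w
      n≡ = trans (HasDegree-unique {f} {productₚ ls} f≈ f-degree (productₚ-degree linear)) (sym degree≡)
      full : Satisfies w (1ₚ , 1)
      full i i< eq = nonzero i (subst (i ≤_) (sym n≡) (ℕ.≤-pred i<)) (begin
        coeff f i                  ≡⟨ trans (f≈ i) (ls≈ i) ⟩
        coeff (c ·ₚ wordPoly w) i  ≡⟨ coeff-·ₚ c (wordPoly w) i ⟩
        c * coeff (wordPoly w) i   ≡⟨ cong (c *_) (trans (sym (*ₚ-identityˡ (wordPoly w) i)) eq) ⟩
        c * 0#                     ≡⟨ zeroʳ c ⟩
        0#                         ∎)
      ds , ds≡ = toDigits 4 (suc n)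
  -- The induction starts from the empty `T`, for which fullness is the only requirement.
  in ℕ.m+n≤o⇒m≤o _ (countNonzero-bound ds w [] (from-yes (Any.any? (List.≡-dec _≟_ []) unitSubsets)) (full ∷ [])
       (trans ds≡ (cong suc n≡)))
  where open ≡-Reasoning

-- The digits of 32, 37 and 31 are those of a path of the finite check along
-- which T grows from ∅ by one element at each of the three lower digits of 101.
extremalFactors : List Poly
extremalFactors = replicate 32 (1+ 1# X) ++ replicate 37 (1+ ω X) ++ replicate 31 (1+ ω² X)

1+X-linear : ∀ {t} → t ≢ 0# → Linear (1+ t X)
1+X-linear t≢0 = t≢0 , λ { (suc (suc m)) _ → refl ; (suc zero) (s≤s ()) }

extremalFactors-linear : All Linear extremalFactors
extremalFactors-linear =
  All.++⁺ (All.replicate⁺ 32 (1+X-linear λ ()))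
    (All.++⁺ (All.replicate⁺ 37 (1+X-linear λ ())) (All.replicate⁺ 31 (1+X-linear λ ())))

coeff-All : ∀ {P : 𝔽₄ → Set} p → All P p → ∀ i → i < length p → P (coeff p i)
coeff-All (_ ∷ _) (px ∷ _)  zero    _        = px
coeff-All (_ ∷ p) (_  ∷ ps) (suc i) (s≤s i<) = coeff-All p ps i i<

-- The product evaluates to a list of exactly 101 entries, so testing each entry covers all indices
-- up to 100.
extremal-nonzero : AllCoefficientsNonzeroUpTo 100 (productₚ extremalFactors)
extremal-nonzero i i≤100 =
  coeff-All {_≢ 0#} (productₚ extremalFactors)
    (from-yes (All.all? (λ a → ¬? (a ≟ 0#)) (productₚ extremalFactors))) i (s≤s i≤100)

mainTheorem3 : (∀ (f : Poly) (n : ℕ) →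
    HasDegree f n →
    IsProductOfLinearFactors f →
    AllCoefficientsNonzeroUpTo n f →
    nonzeroDigits₄ (suc n) ≤ 4)
    ×
    (∃[ f ] ∃[ n ]
    HasDegree f n ×
    IsProductOfLinearFactors f ×
    AllCoefficientsNonzeroUpTo n f ×
    nonzeroDigits₄ (suc n) ≡ 4)
mainTheorem3 = digits-bound ,
  -- The base 4 expansion of 101 is 1211, with four nonzero digits.
  productₚ extremalFactors , 100 , productₚ-degree extremalFactors-linear ,
  (extremalFactors , extremalFactors-linear , λ _ → refl) , extremal-nonzero , refl
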